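{- Let $A$ be an inhabited simple type whose free variables are $X_1,\dots,X_n$. If $A$ is positively non-duplicated and $d(A)\le2$, then $\forall X_1\dots\forall X_n.A\equiv_{\mathsf Y}0+1+\dots+1$ (a finite sum of copies of $1$).
   Context: **Types.** Types are given by $A,B::=X\mid A\Rightarrow B\mid\forall X.A\mid 0\mid 1\mid A+B\mid A\times B\mid \mu X.A\mid\nu X.A$, where $X$ ranges over type variables and $\mu X.A,\nu X.A$ are allowed only when all occurrences of $X$ in $A$ are positive; types are taken up to renaming of bound variables. An occurrence of a variable is positive if it lies to the left of an even number of arrows, negative otherwise. For a finite list $\langle C_i\rangle_i$, $\langle C_i\rangle_i\Rightarrow B$ denotes $C_1\Rightarrow\dots\Rightarrow C_k\Rightarrow B$ (just $B$ if the list is empty). Empty sums and products are $0$ and $1$. $\exists\vec Y.A$ is shorthand for $\forall Y'.(\forall\vec Y.(A\Rightarrow Y'))\Rightarrow Y'$ with $Y'$ fresh (and is $A$ if $\vec Y$ is empty). All substitutions are capture-avoiding. **The relation $\equiv_{\mathsf Y}$.** It is the smallest congruence on types (equivalence relation compatible with all type constructors) containing: (Y+) $\forall X.\forall\vec Y.\big\langle\forall\vec Z_k.\langle A_{jk}\rangle_{j\in J_k}\Rightarrow X\big\rangle_{k\in K}\Rightarrow B\ \equiv\ \forall\vec Y.B\big[\{\mu X.\}\sum_{k}\exists\vec Z_k.\prod_{j}A_{jk}\,/\,X\big]$, whenever $X$ has only positive occurrences in each $A_{jk}$ and in $B$; (Y−) $\forall X.\forall\vec Y.\big\langle\forall\vec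 Z_k.X\Rightarrow A_k\big\rangle_{k\in K}\Rightarrow B\ \equiv\ \forall\vec Y.B\big[\{\nu X.\}\prod_k\forall\vec Z_k.A_k\,/\,X\big]$, whenever $X$ has only positive occurrences in each $A_k$ and only negative occurrences in $B$; here $\{\mu X.\}$, $\{\nu X.\}$ mean that the binder is written only if $X$ occurs in some $A_{jk}$ (resp. $A_k$); together with the $\beta\eta$-isomorphisms: $A\Rightarrow(B\Rightarrow C)\equiv B\Rightarrow(A\Rightarrow C)$; $\forall X.\forall Y.A\equiv\forall Y.\forall X.A$; $A\equiv\forall X.A$ and $A\Rightarrow\forall X.B\equiv\forall X.(A\Rightarrow B)$ for $X$ not free in $A$; $A\times1\equiv A$; $1\Rightarrow A\equiv A$; associativity and commutativity of $\times$; $(A\times B)\Rightarrow C\equiv A\Rightarrow(B\Rightarrow C)$; $A\Rightarrow(B\times C)\equiv(A\Rightarrow B)\times(A\Rightarrow C)$; $\forall X.(A\times B)\equiv\forall X.A\times\forall X.B$; $A+0\equiv A$; $A\times0\equiv0$; $0\Rightarrow A\equiv1$; associativity and commutativity of $+$; $A\times(B+C)\equiv(A\times B)+(A\times C)$; $(A+B)\Rightarrow C\equiv(A\Rightarrow C)\times(B\Rightarrow C)$; $\mu X.A\equiv\nu X.A\equiv A$ for $X$ not free in $A$; $\mu X.A\equiv A[\mu X.A/X]$; $\nu X.A\equiv A[\nu X.A/X]$. **Simple types.** A simple type is built from variables and $\Rightarrow$ only. It is inhabited if there is a closed simply typed $\lambda$-term of that type. A simple type is *positively non-duplicated* if no variable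 has two positive occurrences in it. The depth is $d(X)=0$, $d(A\Rightarrow B)=\max\{d(A)+1,d(B)\}$. -}

module Defs where

open import Data.Nat.Base using (ℕ; zero; suc; _+_; _⊔_)
open import Data.Fin.Base using (Fin; zero; suc; lift; splitAt; _↑ˡ_; _↑ʳ_)
open import Data.List.Base using (List; []; _∷_; foldr; map)
open import Data.List.Membership.Propositional using (_∈_)
open import Data.List.Relation.Unary.All using (All)
open import Data.Product.Base using (∃)
open import Data.Sign.Base as Sign using (Sign; opposite)
open import Data.Sum.Base using ([_,_]′)
open import Function.Base using (_∘_)
open import Relation.Nullary using (¬_; Irrelevant)

infixr 6 _⇒_ _⇒*_
infixl 7 _⊕_
infixl 8 _⊗_
infix  9 _[_]
infix  4 _≈Y_ _≡Y_ _⊢_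

-- Raw types with at most n free variables, in de Bruijn notation, so that
-- α-equivalent types are equal.  The positivity restriction on μ and ν is
-- imposed by the predicate WF below; the types proper are the
-- well-formed raw types.

data Ty (n : ℕ) : Set where
  var     : Fin n → Ty n
  _⇒_     : Ty n → Ty n → Ty n
  ∀'      : Ty (suc n) → Ty n
  𝟘 𝟙     : Ty n
  _⊕_ _⊗_ : Ty n → Ty n → Ty n
  μ ν     : Ty (suc n) → Ty n

-- The elements of Occ s x A are the individual free occurrences of x in A
-- having sign s.
data Occ {n : ℕ} : Sign → Fin n → Ty n → Set where
  here : ∀ {x} → Occ Sign.+ x (var x)
  ⇒ˡ   : ∀ {s x A B} → Occ (opposite s) x A → Occ s x (A ⇒ B)
  ⇒ʳ   : ∀ {s x A B} → Occ s x B → Occ s x (A ⇒ B)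
  ⊕ˡ   : ∀ {s x A B} → Occ s x A → Occ s x (A ⊕ B)
  ⊕ʳ   : ∀ {s x A B} → Occ s x B → Occ s x (A ⊕ B)
  ⊗ˡ   : ∀ {s x A B} → Occ s x A → Occ s x (A ⊗ B)
  ⊗ʳ   : ∀ {s x A B} → Occ s x B → Occ s x (A ⊗ B)
  in-∀ : ∀ {s x A} → Occ s (suc x) A → Occ s x (∀' A)
  in-μ : ∀ {s x A} → Occ s (suc x) A → Occ s x (μ A)
  in-ν : ∀ {s x A} → Occ s (suc x) A → Occ s x (ν A)

Occurs : ∀ {n} → Fin n → Ty n → Set
Occurs x A = ∃ λ s → Occ s x A

OnlyPos OnlyNeg : ∀ {n} → Fin n → Ty n → Set
OnlyPos x A = ¬ Occ Sign.- x A
OnlyNeg x A = ¬ Occ Sign.+ x A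

data WF {n : ℕ} : Ty n → Set where
  var : ∀ x → WF (var x)
  _⇒_ : ∀ {A B} → WF A → WF B → WF (A ⇒ B)
  ∀'  : ∀ {A} → WF A → WF (∀' A)
  𝟘   : WF 𝟘
  𝟙   : WF 𝟙
  _⊕_ : ∀ {A B} → WF A → WF B → WF (A ⊕ B)
  _⊗_ : ∀ {A B} → WF A → WF B → WF (A ⊗ B)
  μ   : ∀ {A} → OnlyPos zero A → WF A → WF (μ A)
  ν   : ∀ {A} → OnlyPos zero A → WF A → WF (ν A)

ren : ∀ {m n} → (Fin m → Fin n) → Ty m → Ty n
ren ρ (var x) = var (ρ x)
ren ρ (A ⇒ B) = ren ρ A ⇒ ren ρ B
ren ρ (∀' A)  = ∀' (ren (lift 1 ρ) A)
ren ρ 𝟘       = 𝟘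
ren ρ 𝟙       = 𝟙
ren ρ (A ⊕ B) = ren ρ A ⊕ ren ρ B
ren ρ (A ⊗ B) = ren ρ A ⊗ ren ρ B
ren ρ (μ A)   = μ (ren (lift 1 ρ) A)
ren ρ (ν A)   = ν (ren (lift 1 ρ) A)

-- "X not free in A", for X the variable zero, is rendered as "A is wk of
-- something".
wk : ∀ {n} → Ty n → Ty (suc n)
wk = ren suc

exts : ∀ {m n} → (Fin m → Ty n) → Fin (suc m) → Ty (suc n)
exts σ zero    = var zero
exts σ (suc x) = wk (σ x)

sub : ∀ {m n} → (Fin m → Ty n) → Ty m → Ty n
sub σ (var x) = σ x
sub σ (A ⇒ B) = sub σ A ⇒ sub σ B
sub σ (∀' A)  = ∀' (sub (exts σ) A)
sub σ 𝟘       = 𝟘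
sub σ 𝟙       = 𝟙
sub σ (A ⊕ B) = sub σ A ⊕ sub σ B
sub σ (A ⊗ B) = sub σ A ⊗ sub σ B
sub σ (μ A)   = μ (sub (exts σ) A)
sub σ (ν A)   = ν (sub (exts σ) A)

_[_] : ∀ {n} → Ty (suc n) → Ty n → Ty n
A [ B ] = sub (λ { zero → B ; (suc x) → var x }) A

swap₀₁ : ∀ {n} → Fin (suc (suc n)) → Fin (suc (suc n))
swap₀₁ zero          = suc zero
swap₀₁ (suc zero)    = zero
swap₀₁ (suc (suc x)) = suc (suc x)

-- In the scope of X followed by m further binders, X is the variable
-- m ↑ʳ zero.  This renaming makes X the innermost variable and keeps the
-- order of all the others.
toFront : ∀ m {n} → Fin (m + suc n) → Fin (suc (m + n))
toFront m {n} x =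
  [ (λ y → suc (y ↑ˡ n))
  , (λ { zero → zero ; (suc z) → suc (m ↑ʳ z) })
  ]′ (splitAt m x)

_⇒*_ : ∀ {n} → List (Ty n) → Ty n → Ty n
Cs ⇒* B = foldr _⇒_ B Cs

∑ : ∀ {n} → List (Ty n) → Ty n
∑ []               = 𝟘
∑ (A ∷ [])         = A
∑ (A ∷ As@(_ ∷ _)) = A ⊕ ∑ As

∏ : ∀ {n} → List (Ty n) → Ty n
∏ []               = 𝟙
∏ (A ∷ [])         = A
∏ (A ∷ As@(_ ∷ _)) = A ⊗ ∏ As

∀^ : ∀ p {n} → Ty (p + n) → Ty n
∀^ zero    A = A
∀^ (suc p) A = ∀^ p (∀' A)

-- The fresh variable Y' is bound outside the p quantified variables; in
-- their scope it is p ↑ʳ zero.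
∃^ : ∀ p {n} → Ty (p + n) → Ty n
∃^ zero      A = A
∃^ p@(suc _) A =
  ∀' (∀^ p (ren (lift p suc) A ⇒ var (p ↑ʳ zero)) ⇒ var zero)

-- ∀ Z₁ … Z_arity. ⟨domains⟩ ⇒ X
record Clause⁺ (n : ℕ) : Set where
  constructor clause
  field
    arity   : ℕ
    domains : List (Ty (arity + n))

-- ∀ Z₁ … Z_arity. X ⇒ codomain
record Clause⁻ (n : ℕ) : Set where
  constructor clause
  field
    arity    : ℕ
    codomain : Ty (arity + n)

premise⁺ : ∀ {n} → Fin n → Clause⁺ n → Ty n
premise⁺ x (clause p As) = ∀^ p (As ⇒* var (p ↑ʳ x))

premise⁻ : ∀ {n} → Fin n → Clause⁻ n → Ty n
premise⁻ x (clause p A) = ∀^ p (var (p ↑ʳ x) ⇒ A)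

OnlyPos⁺ : ∀ {n} → Fin n → Clause⁺ n → Set
OnlyPos⁺ x (clause p As) = All (OnlyPos (p ↑ʳ x)) As

OnlyPos⁻ : ∀ {n} → Fin n → Clause⁻ n → Set
OnlyPos⁻ x (clause p A) = OnlyPos (p ↑ʳ x) A

-- ∑ₖ ∃Zₖ. ∏ⱼ Aⱼₖ and ∏ₖ ∀Zₖ. Aₖ, with the free variables renamed by ρ.
body⁺ : ∀ {m n} → (Fin m → Fin n) → List (Clause⁺ m) → Ty n
body⁺ ρ Ks =
  ∑ (map (λ { (clause p As) → ∃^ p (∏ (map (ren (lift p ρ)) As)) }) Ks)

body⁻ : ∀ {m n} → (Fin m → Fin n) → List (Clause⁻ m) → Ty n
body⁻ ρ Ks =
  ∏ (map (λ { (clause p A) → ∀^ p (ren (lift p ρ) A) }) Ks)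

-- OptBind b C S says that S is {b X.}C: the binder b (μ or ν) is written
-- exactly when X, the variable zero, occurs in C.
data OptBind {n : ℕ} (b : Ty (suc n) → Ty n) : Ty (suc n) → Ty n → Set where
  written : ∀ {C} → Occurs zero C → OptBind b C (b C)
  omitted : ∀ {S} → OptBind b (wk S) S

data _≈Y_ {n : ℕ} : Ty n → Ty n → Set where

  Y+ : ∀ m (Ks : List (Clause⁺ (m + suc n))) (B : Ty (m + suc n))
         (S : Ty (m + n)) →
       All (OnlyPos⁺ (m ↑ʳ zero)) Ks →
       OnlyPos (m ↑ʳ zero) B →
       OptBind μ (body⁺ (toFront m) Ks) S →
       ∀' (∀^ m (map (premise⁺ (m ↑ʳ zero)) Ks ⇒* B))
         ≈Y ∀^ m (ren (toFront m) B [ S ])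

  Y- : ∀ m (Ks : List (Clause⁻ (m + suc n))) (B : Ty (m + suc n))
         (S : Ty (m + n)) →
       All (OnlyPos⁻ (m ↑ʳ zero)) Ks →
       OnlyNeg (m ↑ʳ zero) B →
       OptBind ν (body⁻ (toFront m) Ks) S →
       ∀' (∀^ m (map (premise⁻ (m ↑ʳ zero)) Ks ⇒* B))
         ≈Y ∀^ m (ren (toFront m) B [ S ])

  ⇒-swap   : ∀ A B C → A ⇒ (B ⇒ C) ≈Y B ⇒ (A ⇒ C)
  ∀-swap   : ∀ A → ∀' (∀' A) ≈Y ∀' (∀' (ren swap₀₁ A))
  ∀-vac    : ∀ A → A ≈Y ∀' (wk A)
  ⇒-∀      : ∀ A B → A ⇒ ∀' B ≈Y ∀' (wk A ⇒ B)

  ⊗-unit   : ∀ A → A ⊗ 𝟙 ≈Y A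
  𝟙-⇒      : ∀ A → 𝟙 ⇒ A ≈Y A
  ⊗-assoc  : ∀ A B C → (A ⊗ B) ⊗ C ≈Y A ⊗ (B ⊗ C)
  ⊗-comm   : ∀ A B → A ⊗ B ≈Y B ⊗ A
  curry    : ∀ A B C → (A ⊗ B) ⇒ C ≈Y A ⇒ (B ⇒ C)
  ⇒-⊗      : ∀ A B C → A ⇒ (B ⊗ C) ≈Y (A ⇒ B) ⊗ (A ⇒ C)
  ∀-⊗      : ∀ A B → ∀' (A ⊗ B) ≈Y ∀' A ⊗ ∀' B

  ⊕-unit   : ∀ A → A ⊕ 𝟘 ≈Y A
  ⊗-zero   : ∀ A → A ⊗ 𝟘 ≈Y 𝟘
  𝟘-⇒      : ∀ A → 𝟘 ⇒ A ≈Y 𝟙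
  ⊕-assoc  : ∀ A B C → (A ⊕ B) ⊕ C ≈Y A ⊕ (B ⊕ C)
  ⊕-comm   : ∀ A B → A ⊕ B ≈Y B ⊕ A
  ⊗-⊕      : ∀ A B C → A ⊗ (B ⊕ C) ≈Y (A ⊗ B) ⊕ (A ⊗ C)
  ⊕-⇒      : ∀ A B C → (A ⊕ B) ⇒ C ≈Y (A ⇒ C) ⊗ (B ⇒ C)

  μ-vac    : ∀ A → μ (wk A) ≈Y A
  ν-vac    : ∀ A → ν (wk A) ≈Y A
  μ-unfold : ∀ A → μ A ≈Y A [ μ A ]
  ν-unfold : ∀ A → ν A ≈Y A [ ν A ]

-- The smallest congruence on well-formed types containing the equations
-- above; related raw types are always well-formed.
data _≡Y_ {n : ℕ} : Ty n → Ty n → Set where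
  axiom   : ∀ {A B} → WF A → WF B → A ≈Y B → A ≡Y B
  ≡-refl  : ∀ {A} → WF A → A ≡Y A
  ≡-sym   : ∀ {A B} → A ≡Y B → B ≡Y A
  ≡-trans : ∀ {A B C} → A ≡Y B → B ≡Y C → A ≡Y C
  ⇒-cong  : ∀ {A A′ B B′} → A ≡Y A′ → B ≡Y B′ → A ⇒ B ≡Y A′ ⇒ B′
  ∀-cong  : ∀ {A A′} → A ≡Y A′ → ∀' A ≡Y ∀' A′
  ⊕-cong  : ∀ {A A′ B B′} → A ≡Y A′ → B ≡Y B′ → A ⊕ B ≡Y A′ ⊕ B′
  ⊗-cong  : ∀ {A A′ B B′} → A ≡Y A′ → B ≡Y B′ → A ⊗ B ≡Y A′ ⊗ B′
  μ-cong  : ∀ {A A′} → OnlyPos zero A → OnlyPos zero A′ →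
            A ≡Y A′ → μ A ≡Y μ A′
  ν-cong  : ∀ {A A′} → OnlyPos zero A → OnlyPos zero A′ →
            A ≡Y A′ → ν A ≡Y ν A′

data STy (n : ℕ) : Set where
  var : Fin n → STy n
  _⇒_ : STy n → STy n → STy n

⌜_⌝ : ∀ {n} → STy n → Ty n
⌜ var x ⌝ = var x
⌜ A ⇒ B ⌝ = ⌜ A ⌝ ⇒ ⌜ B ⌝

depth : ∀ {n} → STy n → ℕ
depth (var x) = 0
depth (A ⇒ B) = suc (depth A) ⊔ depth B

data _⊢_ {n : ℕ} (Γ : List (STy n)) : STy n → Set where
  var : ∀ {A} → A ∈ Γ → Γ ⊢ A
  lam : ∀ {A B} → (A ∷ Γ) ⊢ B → Γ ⊢ (A ⇒ B)
  app : ∀ {A B} → Γ ⊢ (A ⇒ B) → Γ ⊢ A → Γ ⊢ B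

Inhabited : ∀ {n} → STy n → Set
Inhabited A = [] ⊢ A

PositivelyNonDuplicated : ∀ {n} → STy n → Set
PositivelyNonDuplicated A = ∀ x → Irrelevant (Occ Sign.+ x ⌜ A ⌝)

∀-closure : ∀ {n} → Ty n → Ty 0
∀-closure {zero}  A = A
∀-closure {suc n} A = ∀-closure (∀' A)

0+1+…+1 : ∀ {n} → ℕ → Ty n
0+1+…+1 zero    = 𝟘
0+1+…+1 (suc k) = 0+1+…+1 k ⊕ 𝟙

-- At depth at most 2 the premises of A are clauses ys ⇒ z, so A is a system of
-- clauses (polynomials ⇒ variable) with a polynomial conclusion, in which each
-- variable occurs at most once outside the heads of the clauses.  By Y+ an
-- innermost quantified X is eliminated by substituting for it the sum Q of the
-- bodies of the clauses with head X, or μX.Q if X occurs in Q.  In the latter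
-- case X occurs nowhere else, so nothing is substituted and no μ survives; in
-- the former the only occurrence of X is replaced by Q, whose clauses disappear.
-- Either way one gets a system of the same kind, and without variables left
-- only a closed polynomial remains.
module Submission where

open import Defs
open import Data.Bool.Base using (true; false; if_then_else_)
open import Data.Fin.Base using (Fin; zero; suc)
open import Data.Fin.Properties using (_≟_)
open import Data.List.Base using (List; []; _∷_; map)
open import Data.List.Properties using (map-∘)
open import Data.List.Relation.Unary.All using (All; []; _∷_)
open import Data.Nat.Base using (ℕ; zero; suc; _+_; _*_; _≤_; z≤n; s≤s; s≤s⁻¹)
open import Data.Nat.ListAction using (sum)
open import Data.Nat.Properties hiding (_≟_)
open import Data.Nat.Tactic.RingSolver using (solve-∀)
open import Data.Product.Base using (∃; _×_; _,_; proj₁)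
open import Data.Sign.Base as Sign using (Sign; opposite)
open import Data.Sum.Base using (_⊎_; inj₁; inj₂)
open import Function.Base using (_∘_)
open import Relation.Binary.PropositionalEquality
  using (_≡_; refl; sym; trans; cong; cong₂; subst; module ≡-Reasoning)
open import Relation.Nullary using (Irrelevant; does; yes)

private
  variable
    m n k : ℕ

-- Polynomials, their occurrence counts and substitution.

data Poly (n : ℕ) : Set where
  var     : Fin n → Poly n
  𝟘 𝟙     : Poly n
  _⊕_ _⊗_ : Poly n → Poly n → Poly n

⟦_⟧ : Poly n → Ty n
⟦ var x ⟧ = var x
⟦ 𝟘 ⟧     = 𝟘
⟦ 𝟙 ⟧     = 𝟙
⟦ P ⊕ Q ⟧ = ⟦ P ⟧ ⊕ ⟦ Q ⟧
⟦ P ⊗ Q ⟧ = ⟦ P ⟧ ⊗ ⟦ Q ⟧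

bind : (Fin m → Poly n) → Poly m → Poly n
bind τ (var x) = τ x
bind τ 𝟘       = 𝟘
bind τ 𝟙       = 𝟙
bind τ (P ⊕ Q) = bind τ P ⊕ bind τ Q
bind τ (P ⊗ Q) = bind τ P ⊗ bind τ Q

single : Poly n → Fin (suc n) → Poly n
single R zero    = R
single R (suc x) = var x

δ : Fin n → Fin n → ℕ
δ x y = if does (x ≟ y) then 1 else 0

count : Fin n → Poly n → ℕ
count x (var y) = δ x y
count x 𝟘       = 0
count x 𝟙       = 0
count x (P ⊕ Q) = count x P + count x Q
count x (P ⊗ Q) = count x P + count x Q

sumᴾ : List (Poly n) → Poly n
sumᴾ []               = 𝟘
sumᴾ (P ∷ [])         = P
sumᴾ (P ∷ Ps@(_ ∷ _)) = P ⊕ sumᴾ Ps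

prodᴾ : List (Poly n) → Poly n
prodᴾ []               = 𝟙
prodᴾ (P ∷ [])         = P
prodᴾ (P ∷ Ps@(_ ∷ _)) = P ⊗ prodᴾ Ps

WF-⟦⟧ : (P : Poly n) → WF ⟦ P ⟧
WF-⟦⟧ (var x) = var x
WF-⟦⟧ 𝟘       = 𝟘
WF-⟦⟧ 𝟙       = 𝟙
WF-⟦⟧ (P ⊕ Q) = WF-⟦⟧ P ⊕ WF-⟦⟧ Q
WF-⟦⟧ (P ⊗ Q) = WF-⟦⟧ P ⊗ WF-⟦⟧ Q

⟦⟧-onlyPos : ∀ {x} (P : Poly n) → OnlyPos x ⟦ P ⟧
⟦⟧-onlyPos (P ⊕ Q) (⊕ˡ o) = ⟦⟧-onlyPos P o
⟦⟧-onlyPos (P ⊕ Q) (⊕ʳ o) = ⟦⟧-onlyPos Q o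
⟦⟧-onlyPos (P ⊗ Q) (⊗ˡ o) = ⟦⟧-onlyPos P o
⟦⟧-onlyPos (P ⊗ Q) (⊗ʳ o) = ⟦⟧-onlyPos Q o

-- Supplies the occurrence that must be exhibited when a `μ` is written.
count⇒Occ : ∀ x (P : Poly n) → count x P ≡ suc k → Occ Sign.+ x ⟦ P ⟧
count⇒Occ x (var y) eq with x ≟ y
... | yes refl = here
count⇒Occ x (P ⊕ Q) eq with count x P in eqP
... | zero  = ⊕ʳ (count⇒Occ x Q eq)
... | suc _ = ⊕ˡ (count⇒Occ x P eqP)
count⇒Occ x (P ⊗ Q) eq with count x P in eqP
... | zero  = ⊗ʳ (count⇒Occ x Q eq)
... | suc _ = ⊗ˡ (count⇒Occ x P eqP)

-- An occurrence after substitution was there before or lies in one of the `b` inserted copies, each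
-- contributing `c`. Such counts have the form `a + b * c`, which is stable under sums.
+-affine : ∀ a b c d e → (a + b * c) + (d + e * c) ≡ (a + d) + (b + e) * c
+-affine = solve-∀

count-single : ∀ (R : Poly n) y P →
  count y (bind (single R) P) ≡ count (suc y) P + count zero P * count y R
count-single R y (var zero)    = sym (+-identityʳ _)
count-single R y (var (suc x)) = sym (+-identityʳ _)
count-single R y 𝟘 = refl
count-single R y 𝟙 = refl
count-single R y (P ⊕ Q)
  rewrite count-single R y P | count-single R y Q =
  +-affine (count (suc y) P) (count zero P) (count y R) _ _
count-single R y (P ⊗ Q)
  rewrite count-single R y P | count-single R y Q =
  +-affine (count (suc y) P) (count zero P) (count y R) _ _

count-sumᴾ : ∀ (x : Fin n) Ps → count x (sumᴾ Ps) ≡ sum (map (count x) Ps)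
count-sumᴾ x []               = refl
count-sumᴾ x (P ∷ [])         = sym (+-identityʳ _)
count-sumᴾ x (P ∷ Ps@(_ ∷ _)) = cong (count x P +_) (count-sumᴾ x Ps)

count-prodᴾ : ∀ (x : Fin n) Ps → count x (prodᴾ Ps) ≡ sum (map (count x) Ps)
count-prodᴾ x []               = refl
count-prodᴾ x (P ∷ [])         = sym (+-identityʳ _)
count-prodᴾ x (P ∷ Ps@(_ ∷ _)) = cong (count x P +_) (count-prodᴾ x Ps)

ren-toFront₀ : (P : Poly (suc n)) → ren (toFront 0) ⟦ P ⟧ ≡ ⟦ P ⟧
ren-toFront₀ (var zero)    = refl
ren-toFront₀ (var (suc x)) = refl
ren-toFront₀ 𝟘       = refl
ren-toFront₀ 𝟙       = refl
ren-toFront₀ (P ⊕ Q) = cong₂ _⊕_ (ren-toFront₀ P) (ren-toFront₀ Q)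
ren-toFront₀ (P ⊗ Q) = cong₂ _⊗_ (ren-toFront₀ P) (ren-toFront₀ Q)

-- Brings a polynomial without the variable zero into the form `wk S` that `omitted` demands.
wk-single : ∀ (R : Poly n) P → count zero P ≡ 0 →
  wk ⟦ bind (single R) P ⟧ ≡ ⟦ P ⟧
wk-single R (var (suc x)) eq = refl
wk-single R 𝟘 eq = refl
wk-single R 𝟙 eq = refl
wk-single R (P ⊕ Q) eq =
  cong₂ _⊕_ (wk-single R P (m+n≡0⇒m≡0 _ eq))
            (wk-single R Q (m+n≡0⇒n≡0 (count zero P) eq))
wk-single R (P ⊗ Q) eq =
  cong₂ _⊗_ (wk-single R P (m+n≡0⇒m≡0 _ eq))
            (wk-single R Q (m+n≡0⇒n≡0 (count zero P) eq))

-- Systems of clauses and substitution in them.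

WF-⇒* : ∀ {As} {B : Ty n} → All WF As → WF B → WF (As ⇒* B)
WF-⇒* []       b = b
WF-⇒* (a ∷ as) b = a ⇒ WF-⇒* as b

WF-map⟦⟧ : (Ps : List (Poly n)) → All WF (map ⟦_⟧ Ps)
WF-map⟦⟧ []       = []
WF-map⟦⟧ (P ∷ Ps) = WF-⟦⟧ P ∷ WF-map⟦⟧ Ps

onlyPos-map⟦⟧ : ∀ {x} (Ps : List (Poly n)) → All (OnlyPos x) (map ⟦_⟧ Ps)
onlyPos-map⟦⟧ []       = []
onlyPos-map⟦⟧ (P ∷ Ps) = ⟦⟧-onlyPos P ∷ onlyPos-map⟦⟧ Ps

-- In a system the variables heading the clauses need not be all those in
-- scope: ι embeds the former into the latter.
system : (Fin m → Fin n) → List (List (Poly n) × Fin m) → Poly n → Ty n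
system ι L H = map (λ (Ps , x) → map ⟦_⟧ Ps ⇒* var (ι x)) L ⇒* ⟦ H ⟧

WF-system : ∀ (ι : Fin m → Fin n) L H → WF (system ι L H)
WF-system ι []             H = WF-⟦⟧ H
WF-system ι ((Ps , x) ∷ L) H = WF-⇒* (WF-map⟦⟧ Ps) (var (ι x)) ⇒ WF-system ι L H

counts : Fin n → List (Poly n) → ℕ
counts x Ps = sum (map (count x) Ps)

-- In a system the heads of clauses occur negatively, their domains and the conclusion positively.
-- Leaving heads out thus counts the positive occurrences in the premises.
countᴸ : ∀ {A : Set} → Fin n → List (List (Poly n) × A) → ℕ
countᴸ x L = sum (map (counts x ∘ proj₁) L)

sum-affine : ∀ {A : Set} {f g h : A → ℕ} {c} →
  (∀ a → f a ≡ g a + h a * c) →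
  ∀ as → sum (map f as) ≡ sum (map g as) + sum (map h as) * c
sum-affine eq [] = refl
sum-affine {g = g} {h} {c} eq (a ∷ as)
  rewrite eq a | sum-affine {g = g} {h} {c} eq as =
  +-affine (g a) (h a) c _ _

substᶜ : ∀ {A : Set} → Poly n → List (Poly (suc n)) × A → List (Poly n) × A
substᶜ R (Ps , x) = map (bind (single R)) Ps , x

counts-single : ∀ (R : Poly n) y Ps →
  counts y (map (bind (single R)) Ps) ≡
  counts (suc y) Ps + counts zero Ps * count y R
counts-single R y Ps =
  trans (cong sum (sym (map-∘ Ps))) (sum-affine (count-single R y) Ps)

countᴸ-single : ∀ {A : Set} (R : Poly n) y (L : List (_ × A)) →
  countᴸ y (map (substᶜ R) L) ≡ countᴸ (suc y) L + countᴸ zero L * count y R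
countᴸ-single R y L =
  trans (cong sum (sym (map-∘ L)))
        (sum-affine (counts-single R y ∘ proj₁) L)

module _ (S : Ty n) (R : Poly n) where

  -- For k the number of occurrences of the variable zero, this says that
  -- substituting S for it is the same as substituting R.
  Agree : ℕ → Set
  Agree k = k ≡ 0 ⊎ S ≡ ⟦ R ⟧

  agreeˡ : ∀ j {k} → Agree (j + k) → Agree j
  agreeˡ j (inj₁ eq) = inj₁ (m+n≡0⇒m≡0 j eq)
  agreeˡ j (inj₂ eq) = inj₂ eq

  agreeʳ : ∀ j {k} → Agree (j + k) → Agree k
  agreeʳ j (inj₁ eq) = inj₁ (m+n≡0⇒n≡0 j eq)
  agreeʳ j (inj₂ eq) = inj₂ eq

  ⟦⟧-subst : ∀ P → Agree (count zero P) →
    ren (toFront 0) ⟦ P ⟧ [ S ] ≡ ⟦ bind (single R) P ⟧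
  -- The count is 1 here, which excludes the first alternative of `Agree`.
  ⟦⟧-subst (var zero) (inj₂ eq) = eq
  ⟦⟧-subst (var (suc x)) ag = refl
  ⟦⟧-subst 𝟘 ag = refl
  ⟦⟧-subst 𝟙 ag = refl
  ⟦⟧-subst (P ⊕ Q) ag =
    cong₂ _⊕_ (⟦⟧-subst P (agreeˡ _ ag)) (⟦⟧-subst Q (agreeʳ (count zero P) ag))
  ⟦⟧-subst (P ⊗ Q) ag =
    cong₂ _⊗_ (⟦⟧-subst P (agreeˡ _ ag)) (⟦⟧-subst Q (agreeʳ (count zero P) ag))

  clause-subst : ∀ Ps (x : Fin n) → Agree (counts zero Ps) →
    ren (toFront 0) (map ⟦_⟧ Ps ⇒* var (suc x)) [ S ] ≡
    map ⟦_⟧ (map (bind (single R)) Ps) ⇒* var x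
  clause-subst []       x ag = refl
  clause-subst (P ∷ Ps) x ag =
    cong₂ _⇒_ (⟦⟧-subst P (agreeˡ _ ag))
              (clause-subst Ps x (agreeʳ (count zero P) ag))

  system-subst : ∀ L H → Agree (countᴸ zero L + count zero H) →
    ren (toFront 0) (system suc L H) [ S ] ≡
    system (λ x → x) (map (substᶜ R) L) (bind (single R) H)
  system-subst []             H ag = ⟦⟧-subst H ag
  system-subst ((Ps , x) ∷ L) H ag
    rewrite +-assoc (counts zero Ps) (countᴸ zero L) (count zero H) =
    cong₂ _⇒_ (clause-subst Ps x (agreeˡ _ ag))
              (system-subst L H (agreeʳ (counts zero Ps) ag))

-- Separating the clauses headed by the variable to be eliminated.

zero-bodies : List (List (Poly (suc n)) × Fin (suc n)) → List (List (Poly (suc n)))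
zero-bodies []                 = []
zero-bodies ((Ps , zero)  ∷ L) = Ps ∷ zero-bodies L
zero-bodies ((Ps , suc _) ∷ L) = zero-bodies L

-- The type `Fin n` records that no remaining head is the variable zero, which is why that variable
-- is only positive in the remaining system.
others : List (List (Poly (suc n)) × Fin (suc n)) → List (List (Poly (suc n)) × Fin n)
others []                 = []
others ((Ps , zero)  ∷ L) = others L
others ((Ps , suc x) ∷ L) = (Ps , x) ∷ others L

-- Arity 0, so that the existentials in Y+ vanish and the sum of bodies is again a polynomial.
clause⁺ : List (Poly n) → Clause⁺ n
clause⁺ Ps = clause 0 (map ⟦_⟧ Ps)

⇒*-move : ∀ {A : Ty n} {Bs C} → WF A → All WF Bs → WF C →
  A ⇒ (Bs ⇒* C) ≡Y Bs ⇒* (A ⇒ C)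
⇒*-move a []       c = ≡-refl (a ⇒ c)
⇒*-move a (b ∷ bs) c =
  ≡-trans (axiom (a ⇒ (b ⇒ bs⇒c)) (b ⇒ (a ⇒ bs⇒c)) (⇒-swap _ _ _))
          (⇒-cong (≡-refl b) (⇒*-move a bs c))
  where bs⇒c = WF-⇒* bs c

WF-premises⁺ : ∀ (x : Fin n) Pss → All WF (map (premise⁺ x) (map clause⁺ Pss))
WF-premises⁺ x []         = []
WF-premises⁺ x (Ps ∷ Pss) = WF-⇒* (WF-map⟦⟧ Ps) (var x) ∷ WF-premises⁺ x Pss

-- Swapping premises brings the clauses headed by the variable zero to the front, as Y+ requires.
system-split : ∀ (L : List (_ × Fin (suc n))) H →
  system (λ x → x) L H ≡Y
  map (premise⁺ zero) (map clause⁺ (zero-bodies L)) ⇒* system suc (others L) H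
system-split []                 H = ≡-refl (WF-⟦⟧ H)
system-split ((Ps , zero) ∷ L)  H =
  ⇒-cong (≡-refl (WF-⇒* (WF-map⟦⟧ Ps) (var zero))) (system-split L H)
system-split ((Ps , suc x) ∷ L) H =
  ≡-trans (⇒-cong (≡-refl c) (system-split L H))
          (⇒*-move c (WF-premises⁺ zero (zero-bodies L)) (WF-system suc (others L) H))
  where c = WF-⇒* (WF-map⟦⟧ Ps) (var (suc x))

onlyPos⁺-clauses : ∀ (x : Fin n) Pss → All (OnlyPos⁺ x) (map clause⁺ Pss)
onlyPos⁺-clauses x []         = []
onlyPos⁺-clauses x (Ps ∷ Pss) = onlyPos-map⟦⟧ Ps ∷ onlyPos⁺-clauses x Pss

clause-onlyNeg : ∀ Ps {x : Fin n} → OnlyNeg zero (map ⟦_⟧ Ps ⇒* var (suc x))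
clause-onlyNeg (P ∷ Ps) (⇒ˡ o) = ⟦⟧-onlyPos P o
clause-onlyNeg (P ∷ Ps) (⇒ʳ o) = clause-onlyNeg Ps o

system-onlyPos : ∀ L (H : Poly (suc n)) → OnlyPos zero (system suc L H)
system-onlyPos []             H o      = ⟦⟧-onlyPos H o
system-onlyPos ((Ps , x) ∷ L) H (⇒ˡ o) = clause-onlyNeg Ps o
system-onlyPos ((Ps , x) ∷ L) H (⇒ʳ o) = system-onlyPos L H o

∏-ren-toFront₀ : (Ps : List (Poly (suc n))) →
  ∏ (map (ren (toFront 0)) (map ⟦_⟧ Ps)) ≡ ⟦ prodᴾ Ps ⟧
∏-ren-toFront₀ []               = refl
∏-ren-toFront₀ (P ∷ [])         = ren-toFront₀ P
∏-ren-toFront₀ (P ∷ Ps@(_ ∷ _)) = cong₂ _⊗_ (ren-toFront₀ P) (∏-ren-toFront₀ Ps)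

bodies-sum : List (List (Poly n)) → Poly n
bodies-sum Pss = sumᴾ (map prodᴾ Pss)

body⁺-clauses : (Pss : List (List (Poly (suc n)))) →
  body⁺ (toFront 0) (map clause⁺ Pss) ≡ ⟦ bodies-sum Pss ⟧
body⁺-clauses []                 = refl
body⁺-clauses (Ps ∷ [])          = ∏-ren-toFront₀ Ps
body⁺-clauses (Ps ∷ Pss@(_ ∷ _)) = cong₂ _⊕_ (∏-ren-toFront₀ Ps) (body⁺-clauses Pss)

countᴸ-split : ∀ x (L : List (_ × Fin (suc n))) →
  countᴸ x L ≡ count x (bodies-sum (zero-bodies L)) + countᴸ x (others L)
countᴸ-split x [] = refl
countᴸ-split x ((Ps , zero) ∷ L) = begin
  counts x Ps + countᴸ x L
    ≡⟨ cong₂ _+_ (sym (count-prodᴾ x Ps)) (countᴸ-split x L) ⟩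
  count x (prodᴾ Ps) + (count x (bodies-sum (zero-bodies L)) + countᴸ x (others L))
    ≡⟨ sym (+-assoc (count x (prodᴾ Ps)) _ _) ⟩
  count x (prodᴾ Ps) + count x (bodies-sum (zero-bodies L)) + countᴸ x (others L)
    -- `sumᴾ` is stuck on a list with unknown tail, so the argument passes through the sum of the
    -- counts.
    ≡⟨ cong (_+ countᴸ x (others L))
         (trans (cong (count x (prodᴾ Ps) +_) (count-sumᴾ x (map prodᴾ (zero-bodies L))))
                (sym (count-sumᴾ x (map prodᴾ (Ps ∷ zero-bodies L))))) ⟩
  count x (bodies-sum (Ps ∷ zero-bodies L)) + countᴸ x (others L) ∎
  where open ≡-Reasoning
countᴸ-split x ((Ps , suc _) ∷ L) =
  trans (cong (counts x Ps +_) (countᴸ-split x L))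
    (x+[y+z] (counts x Ps) (count x (bodies-sum (zero-bodies L))) _)
  where
  x+[y+z] : ∀ a b c → a + (b + c) ≡ b + (a + c)
  x+[y+z] = solve-∀

-- Elimination of one variable.

Linear : List (List (Poly n) × Fin n) → Poly n → Set
Linear L H = ∀ x → countᴸ x L + count x H ≤ 1

module _ (L : List (List (Poly (suc n)) × Fin (suc n))) (H : Poly (suc n)) where

  private
    Q : Poly (suc n)
    Q = bodies-sum (zero-bodies L)

    -- The variable zero is replaced by 𝟘 in Q only to strengthen Q: if it
    -- does occur in Q, then by linearity R is substituted for nothing.
    R : Poly n
    R = bind (single 𝟘) Q

    L′ : List (List (Poly n) × Fin n)
    L′ = map (substᶜ R) (others L)

    H′ : Poly n
    H′ = bind (single R) H

  -- Divides the single permitted occurrence between `Q` and the rest: if it lies in one, the other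
  -- has none.
  linear-split : Linear L H → ∀ x →
    count x Q + (countᴸ x (others L) + count x H) ≤ 1
  linear-split lin x = begin
    count x Q + (countᴸ x (others L) + count x H)
      ≡⟨ sym (+-assoc (count x Q) _ _) ⟩
    count x Q + countᴸ x (others L) + count x H
      ≡⟨ cong (_+ count x H) (sym (countᴸ-split x L)) ⟩
    countᴸ x L + count x H
      ≤⟨ lin x ⟩
    1 ∎
    where open ≤-Reasoning

  -- The rest contains the variable zero at most once, so at most one copy of `R` is inserted, and
  -- the clauses that made up `Q` are gone. What occurs afterwards is bounded by `Q` together with
  -- the rest.
  linear-single : Linear L H → Linear L′ H′
  linear-single lin y = begin
    countᴸ y L′ + count y H′
      ≡⟨ cong₂ _+_ (countᴸ-single R y (others L)) (count-single R y H) ⟩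
    (countᴸ (suc y) (others L) + countᴸ zero (others L) * r) +
      (count (suc y) H + count zero H * r)
      ≡⟨ +-affine (countᴸ (suc y) (others L)) (countᴸ zero (others L)) r _ _ ⟩
    rest (suc y) + rest zero * r
      ≤⟨ +-monoʳ-≤ (rest (suc y))
           (*-monoˡ-≤ r (m+n≤o⇒n≤o (count zero Q) (linear-split lin zero))) ⟩
    rest (suc y) + 1 * r
      ≡⟨ cong (rest (suc y) +_) (*-identityˡ r) ⟩
    rest (suc y) + r
      ≡⟨ cong (rest (suc y) +_) (count-single 𝟘 y Q) ⟩
    rest (suc y) + (count (suc y) Q + count zero Q * 0)
      ≡⟨ cong (λ z → rest (suc y) + (count (suc y) Q + z)) (*-zeroʳ (count zero Q)) ⟩
    rest (suc y) + (count (suc y) Q + 0)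
      ≡⟨ trans (cong (rest (suc y) +_) (+-identityʳ _)) (+-comm (rest (suc y)) _) ⟩
    count (suc y) Q + rest (suc y)
      ≤⟨ linear-split lin (suc y) ⟩
    1 ∎
    where
    open ≤-Reasoning
    r : ℕ
    r = count y R
    rest : Fin (suc n) → ℕ
    rest x = countᴸ x (others L) + count x H

  optBind : Linear L H → ∃ λ S →
    OptBind μ (body⁺ (toFront 0) (map clause⁺ (zero-bodies L))) S ×
    Agree S R (countᴸ zero (others L) + count zero H)
  optBind lin rewrite body⁺-clauses (zero-bodies L)
    with count zero Q in eq | linear-split lin zero
  -- The occurrence in `Q` uses up the whole bound, so `le` leaves none for the rest.
  ... | suc j | s≤s le =
    μ ⟦ Q ⟧ , written (_ , count⇒Occ zero Q eq) , inj₁ (m+n≡0⇒n≡0 j (n≤0⇒n≡0 le))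
  ... | zero  | _      =
    ⟦ R ⟧ , subst (λ C → OptBind μ C ⟦ R ⟧) (wk-single 𝟘 Q eq) omitted , inj₂ refl

  eliminate : Linear L H → ∃ λ L′ → ∃ λ H′ →
    ∀' (system (λ x → x) L H) ≡Y system (λ x → x) L′ H′ × Linear L′ H′
  eliminate lin with optBind lin
  ... | S , opt , agree = L′ , H′ ,
    ≡-trans (∀-cong (system-split L H))
      (subst (_ ≡Y_) subst-eq
        (axiom (∀' (WF-⇒* (WF-premises⁺ zero (zero-bodies L)) wfB))
               -- Well-formedness of the substituted type is read off the system it equals, also
               -- when `S` is a `μ`.
               (subst WF (sym subst-eq) (WF-system (λ x → x) L′ H′))
          (Y+ 0 (map clause⁺ (zero-bodies L)) (system suc (others L) H) S
            (onlyPos⁺-clauses zero (zero-bodies L))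
            (system-onlyPos (others L) H) opt))) ,
    linear-single lin
    where
    wfB = WF-system suc (others L) H
    subst-eq = system-subst S R (others L) H agree

-- Arithmetic of numerals and elimination of all variables.

WF-0+1+…+1 : ∀ k → WF (0+1+…+1 {n} k)
WF-0+1+…+1 zero    = 𝟘
WF-0+1+…+1 (suc k) = WF-0+1+…+1 k ⊕ 𝟙

-- Recursion is on the right summand; the order `k + j` makes the index compute along it.
0+1+…+1-⊕ : ∀ j k → 0+1+…+1 {n} j ⊕ 0+1+…+1 k ≡Y 0+1+…+1 (k + j)
0+1+…+1-⊕ j zero    = axiom (WF-0+1+…+1 j ⊕ 𝟘) (WF-0+1+…+1 j) (⊕-unit _)
0+1+…+1-⊕ j (suc k) =
  ≡-trans (≡-sym (axiom ((J ⊕ K) ⊕ 𝟙) (J ⊕ (K ⊕ 𝟙)) (⊕-assoc _ _ _)))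
          (⊕-cong (0+1+…+1-⊕ j k) (≡-refl 𝟙))
  where
  J = WF-0+1+…+1 j
  K = WF-0+1+…+1 k

0+1+…+1-⊗ : ∀ j k → 0+1+…+1 {n} j ⊗ 0+1+…+1 k ≡Y 0+1+…+1 (k * j)
0+1+…+1-⊗ j zero    = axiom (WF-0+1+…+1 j ⊗ 𝟘) 𝟘 (⊗-zero _)
0+1+…+1-⊗ j (suc k) =
  ≡-trans (axiom (J ⊗ (K ⊕ 𝟙)) ((J ⊗ K) ⊕ (J ⊗ 𝟙)) (⊗-⊕ _ _ _))
    (≡-trans (⊕-cong (0+1+…+1-⊗ j k) (axiom (J ⊗ 𝟙) J (⊗-unit _)))
             (0+1+…+1-⊕ (k * j) j))
  where
  J = WF-0+1+…+1 j
  K = WF-0+1+…+1 k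

poly₀-numeral : (P : Poly 0) → ∃ λ k → ⟦ P ⟧ ≡Y 0+1+…+1 k
poly₀-numeral 𝟘 = 0 , ≡-refl 𝟘
poly₀-numeral 𝟙 = 1 ,
  ≡-trans (≡-sym (axiom (𝟙 ⊕ 𝟘) 𝟙 (⊕-unit 𝟙))) (axiom (𝟙 ⊕ 𝟘) (𝟘 ⊕ 𝟙) (⊕-comm 𝟙 𝟘))
poly₀-numeral (P ⊕ Q) with poly₀-numeral P | poly₀-numeral Q
... | j , p | k , q = k + j , ≡-trans (⊕-cong p q) (0+1+…+1-⊕ j k)
poly₀-numeral (P ⊗ Q) with poly₀-numeral P | poly₀-numeral Q
... | j , p | k , q = k * j , ≡-trans (⊗-cong p q) (0+1+…+1-⊗ j k)

∀-closure-cong : {A B : Ty n} → A ≡Y B → ∀-closure A ≡Y ∀-closure B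
∀-closure-cong {zero}  eq = eq
∀-closure-cong {suc n} eq = ∀-closure-cong (∀-cong eq)

linear-numeral : ∀ (L : List (_ × Fin n)) H → Linear L H →
  ∃ λ k → ∀-closure (system (λ x → x) L H) ≡Y 0+1+…+1 k
-- Without variables no clause has a head, so the list of clauses is empty.
linear-numeral {zero} [] H lin = poly₀-numeral H
linear-numeral {suc n} L H lin with eliminate L H lin
... | L′ , H′ , eq , lin′ with linear-numeral L′ H′ lin′
... | k , eq′ = k , ≡-trans (∀-closure-cong eq) eq′

-- Simple types of depth at most 2 as linear systems.

occs : Sign → Fin n → STy n → ℕ
occs s      x (A ⇒ B) = occs (opposite s) x A + occs s x B
occs Sign.+ x (var y) = δ x y
occs Sign.- x (var y) = 0

occs⇒Occ : ∀ s x (A : STy n) → occs s x A ≡ suc k → Occ s x ⌜ A ⌝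
occs⇒Occ Sign.+ x (var y) eq with x ≟ y
... | yes refl = here
occs⇒Occ s x (A ⇒ B) eq with occs (opposite s) x A in eqA
... | zero  = ⇒ʳ (occs⇒Occ s x B eq)
... | suc _ = ⇒ˡ (occs⇒Occ (opposite s) x A eqA)

-- Irrelevance passes to both sides of an arrow, since `⇒ˡ` and `⇒ʳ` are injective. Occurrences on
-- both sides at once would identify these two constructors.
irrelevant⇒occs≤1 : ∀ s x (A : STy n) → Irrelevant (Occ s x ⌜ A ⌝) → occs s x A ≤ 1
irrelevant⇒occs≤1 Sign.+ x (var y) irr with does (x ≟ y)
... | true  = s≤s z≤n
... | false = z≤n
irrelevant⇒occs≤1 Sign.- x (var y) irr = z≤n
irrelevant⇒occs≤1 s x (A ⇒ B) irr
  with occs (opposite s) x A in eqA | occs s x B in eqB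
     | irrelevant⇒occs≤1 (opposite s) x A (λ o p → ⇒ˡ-injective (irr (⇒ˡ o) (⇒ˡ p)))
     | irrelevant⇒occs≤1 s x B (λ o p → ⇒ʳ-injective (irr (⇒ʳ o) (⇒ʳ p)))
  where
  ⇒ˡ-injective : ∀ {o p} → Occ.⇒ˡ {B = ⌜ B ⌝} o ≡ ⇒ˡ p → o ≡ p
  ⇒ˡ-injective refl = refl
  ⇒ʳ-injective : ∀ {o p} → Occ.⇒ʳ {A = ⌜ A ⌝} o ≡ ⇒ʳ p → o ≡ p
  ⇒ʳ-injective refl = refl
... | zero  | _     | _      | b = b
... | suc _ | zero  | s≤s le | _ = s≤s (≤-trans (≤-reflexive (+-identityʳ _)) le)
... | suc _ | suc _ | _      | _
  with () ← irr (⇒ˡ (occs⇒Occ (opposite s) x A eqA)) (⇒ʳ (occs⇒Occ s x B eqB))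

head : STy n → Fin n
head (var x) = x
head (A ⇒ B) = head B

-- Domains and premises are represented by their heads, resp. as clauses over
-- the heads of their domains; this is faithful only up to depth 1, resp. 2.
domains : STy n → List (Poly n)
domains (var x) = []
domains (A ⇒ B) = var (head A) ∷ domains B

clauses : STy n → List (List (Poly n) × Fin n)
clauses (var x) = []
clauses (A ⇒ B) = (domains A , head A) ∷ clauses B

depth-⇒ : ∀ (A B : STy n) → depth (A ⇒ B) ≤ suc k → depth A ≤ k × depth B ≤ suc k
depth-⇒ A B le =
  s≤s⁻¹ (m⊔n≤o⇒m≤o (suc (depth A)) (depth B) le) , m⊔n≤o⇒n≤o (suc (depth A)) (depth B) le

depth≤0⇒var : (A : STy n) → depth A ≤ 0 → A ≡ var (head A)
depth≤0⇒var (var x) le = refl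
depth≤0⇒var (A ⇒ B) le with () ← m⊔n≤o⇒m≤o (suc (depth A)) (depth B) le

depth≤1⇒clause : (A : STy n) → depth A ≤ 1 →
  ⌜ A ⌝ ≡ map ⟦_⟧ (domains A) ⇒* var (head A)
depth≤1⇒clause (var x) le = refl
depth≤1⇒clause (A ⇒ B) le with leA , leB ← depth-⇒ A B le =
  cong₂ _⇒_ (cong ⌜_⌝ (depth≤0⇒var A leA))
            (depth≤1⇒clause B leB)

depth≤2⇒system : (A : STy n) → depth A ≤ 2 →
  ⌜ A ⌝ ≡ system (λ x → x) (clauses A) (var (head A))
depth≤2⇒system (var x) le = refl
depth≤2⇒system (A ⇒ B) le with leA , leB ← depth-⇒ A B le =
  cong₂ _⇒_ (depth≤1⇒clause A leA)
            (depth≤2⇒system B leB)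

-- At depth at most 1 every domain is a variable, and these are all the negative occurrences.
counts-domains : ∀ x (A : STy n) → depth A ≤ 1 →
  counts x (domains A) ≡ occs Sign.- x A
counts-domains x (var y) le = refl
counts-domains x (A ⇒ B) le with leA , leB ← depth-⇒ A B le =
  cong₂ _+_ (sym (cong (occs Sign.+ x) (depth≤0⇒var A leA)))
            (counts-domains x B leB)

-- Turns positive non-duplication into linearity: a premise contributes its negative occurrences,
-- which are its domains, and the final head is the remaining positive one.
count-clauses : ∀ x (A : STy n) → depth A ≤ 2 →
  countᴸ x (clauses A) + δ x (head A) ≡ occs Sign.+ x A
count-clauses x (var y) le = refl
count-clauses x (A ⇒ B) le with leA , leB ← depth-⇒ A B le =
  trans (+-assoc (counts x (domains A)) _ _)
    (cong₂ _+_ (counts-domains x A leA)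
               (count-clauses x B leB))

proposition3p2 : (n : ℕ) (A : STy n) →
    (∀ (x : Fin n) → Occurs x ⌜ A ⌝) →
    Inhabited A →
    PositivelyNonDuplicated A →
    depth A ≤ 2 →
    ∃ λ (k : ℕ) → ∀-closure ⌜ A ⌝ ≡Y 0+1+…+1 k
proposition3p2 n A _ _ nonDup d≤2 =
  subst (λ T → ∃ λ k → ∀-closure T ≡Y 0+1+…+1 k) (sym (depth≤2⇒system A d≤2))
    (linear-numeral (clauses A) (var (head A)) λ x →
      ≤-trans (≤-reflexive (count-clauses x A d≤2))
              (irrelevant⇒occs≤1 Sign.+ x A (nonDup x)))
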